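{- Fix any input (any fixed initial content of the tape). The set of programs whose computation on this input falls off the tape before reaching the halt state and before repeating a state has asymptotic probability one.
   Context: Model of computation: a single head reads and writes symbols $0,1$ on a one-way infinite tape with cells indexed $0,1,2,\dots$; the head starts on cell $0$. An $n$-state program has states $Q=\{q_1,\dots,q_n\}$, with $q_1$ the start state, plus a separate halt state not in $Q$. A program is a function $p: Q\times\{0,1\}\to (Q\cup\{\mathrm{halt}\})\times\{0,1\}\times\{L,R\}$; $p(q,i)=\langle r,j,d\rangle$ means: in state $q$ reading $i$, write $j$, move one cell in direction $d$, enter state $r$. The computation stops when the halt state is reached ("halting") or when the head attempts to move left from cell $0$ ("falls off the tape"); in the latter case the target state of that transition is not regarded as reached. The computation "repeats a state" if some state occurs twice in the sequence of states $q_1=s_0,s_1,\dots$ reached at successive steps. Let $P_n$ be the set of all $n$-state programs; the asymptotic probability of a set $B$ of programs is $\mu(B)=\lim_{n\to\infty}|B\cap P_n|/|P_n|$, when this limit exists. -}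

module Defs where

open import Data.Bool.Base using (if_then_else_)
open import Data.Fin.Base using (Fin; zero)
open import Data.Integer.Base using (+_)
open import Data.Maybe.Base using (Maybe; just; nothing)
open import Data.Nat.Base using (ℕ; zero; suc; NonZero; _≤_; _<_; _≡ᵇ_)
open import Data.Product.Base using (Σ; Σ-syntax; ∃-syntax; _×_; _,_; proj₁)
open import Data.Rational.Base as ℚ using (ℚ; 0ℚ; _/_; ∣_∣)
open import Function.Bundles using (Inverse)
open import Level using (0ℓ)
open import Relation.Binary.Bundles using (Setoid)
import Relation.Binary.Construct.On as On
open import Relation.Binary.PropositionalEquality using (_≡_; setoid; _→-setoid_)
open import Relation.Nullary.Negation.Core using (¬_)
open import Relation.Unary using (Pred)

Symbol : Set
Symbol = Fin 2

data Direction : Set where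
  L R : Direction

Target : ℕ → Set
Target n = Maybe (Fin n)

pattern halt    = nothing
pattern state q = just q

Action : ℕ → Set
Action n = Target n × Symbol × Direction

Program : ℕ → Set
Program n = Fin n × Symbol → Action n

start : ∀ n → .{{NonZero n}} → Fin n
start (suc n) = zero

Tape : Set
Tape = ℕ → Symbol

write : ℕ → Symbol → Tape → Tape
write h j T i = if i ≡ᵇ h then j else T i

data Status (n : ℕ) : Set where
  running : (q : Fin n) (head : ℕ) (T : Tape) → Status n
  halted  : Status n
  offTape : Status n

move : Direction → ℕ → Maybe ℕ
move L zero    = nothing
move L (suc h) = just h
move R h       = just (suc h)

-- A left move from cell 0 is off the tape whatever the target is, `halt`
-- included: the target of such a transition is not reached.
enter : ∀ {n} → Target n → Maybe ℕ → Tape → Status n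
enter _         nothing  _ = offTape
enter halt      (just _) _ = halted
enter (state q) (just h) T = running q h T

step : ∀ {n} → Program n → Status n → Status n
step p (running q h T) with p (q , T h)
... | r , j , d = enter r (move d h) (write h j T)
step p halted  = halted
step p offTape = offTape

run : ∀ {n} → .{{NonZero n}} → Program n → Tape → ℕ → Status n
run {n} p input zero    = running (start n) 0 input
run     p input (suc t) = step p (run p input t)

InState : ∀ {n} → .{{NonZero n}} → Program n → Tape → ℕ → Fin n → Set
InState p input t q = ∃[ h ] ∃[ T ] run p input t ≡ running q h T

HaltsBy : ∀ {n} → .{{NonZero n}} → Program n → Tape → ℕ → Set
HaltsBy p input t = ∃[ i ] i ≤ t × run p input i ≡ halted

RepeatsStateBy : ∀ {n} → .{{NonZero n}} → Program n → Tape → ℕ → Set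
RepeatsStateBy p input t =
  ∃[ i ] ∃[ j ] i < j × j ≤ t ×
    (∃[ q ] InState p input i q × InState p input j q)

-- `n` ranges over positive numbers of states, since a start state is required.
ProgramSet : Set₁
ProgramSet = ∀ n → .{{NonZero n}} → Pred (Program n) 0ℓ

FallsOffFirst : Tape → ProgramSet
FallsOffFirst input n p =
  ∃[ t ] run p input t ≡ offTape × ¬ HaltsBy p input t × ¬ RepeatsStateBy p input t

-- Programs are functions, so they are compared, and counted, up to pointwise
-- equality.
programs : ℕ → Setoid 0ℓ 0ℓ
programs n = (Fin n × Symbol) →-setoid Action n

_∩P_ : ProgramSet → (n : ℕ) → .{{NonZero n}} → Setoid 0ℓ 0ℓ
B ∩P n = On.setoid {B = Σ (Program n) (B n)} (programs n) proj₁

HasCardinality : Setoid 0ℓ 0ℓ → ℕ → Set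
HasCardinality S m = Inverse S (setoid (Fin m))

-- μ(B) = r, i.e. |B ∩ Pₙ| / |Pₙ| → r as n → ∞.  Rational ε suffice in the
-- definition of the limit.  Cardinalities are unique, so asking for `b` and `c`
-- to exist only adds that the sets are finite.
HasAsymptoticProbability : ProgramSet → ℚ → Set
HasAsymptoticProbability B r =
  ∀ (ε : ℚ) → 0ℚ ℚ.< ε →
  ∃[ N ] ∀ n → .{{_ : NonZero n}} → N ≤ n →
  ∃[ b ] ∃[ c ] Σ[ c≢0 ∈ NonZero c ]
    HasCardinality (B ∩P n) b ×
    HasCardinality (programs n) c ×
    ∣ _/_ (+ b) c {{c≢0}} ℚ.- r ∣ ℚ.< ε

{-# OPTIONS --safe #-}

-- As long as no state repeats, the program entries consulted are independent and uniformly
-- distributed: resampling the entry about to be consulted does not change the average over all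
-- programs.  So each step halts or repeats a state with chance O(k / n), and otherwise moves the
-- head like a simple random walk.  The walk leaves the tape almost surely: on an interval of
-- length M it exits with expected time x (M - x), hence within M² steps it survives from cell 0
-- with chance at most 2 / M.  Fixing M large and then letting n grow gives the theorem.
module Submission where

import Algebra.Properties.Semiring.Sum
open import Data.Bool.Base using (Bool; true; false; not; T; if_then_else_; _∨_)
open import Data.Bool.Properties using (T-irrelevant)
open import Data.Fin.Base using (Fin; zero; suc; toℕ; combine; remQuot; _↑ˡ_; _↑ʳ_; funToFin; finToFun)
open import Data.Fin.Properties
  using (_≟_; pigeonhole; toℕ<n; *↔×; +↔⊎; 1↔⊤; 0↔⊥; remQuot-combine; funToFin-finToFin; finToFun-funToFin)
import Data.Integer.Base as ℤ
import Data.Integer.Properties as ℤ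
open import Data.List.Base using (List; []; _∷_; length)
import Data.List.Membership.DecPropositional as DecMembership
open import Data.List.Membership.Propositional using (_∈_; _∉_)
open import Data.List.Relation.Unary.Any using (here; there)
open import Data.Maybe.Base using (just)
open import Data.Nat.Base
open import Data.Nat.Properties hiding (_≟_)
open import Data.Nat.Tactic.RingSolver using (solve-∀)
open import Data.Product.Base using (Σ; _×_; _,_; proj₁; proj₂; ∃-syntax)
open import Data.Product.Function.NonDependent.Setoid using (_×-inverse_)
open import Data.Product.Properties using (≡-dec)
open import Data.Product.Relation.Binary.Pointwise.NonDependent using (_×ₛ_; Pointwise-≡↔≡)
open import Data.Rational.Base as ℚ using (mkℚ; 0ℚ; 1ℚ; toℚᵘ; ↧ₙ_)
import Data.Rational.Properties as ℚ
open import Data.Rational.Unnormalised.Base as ℚᵘ using (mkℚᵘ)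
import Data.Rational.Unnormalised.Properties as ℚᵘ
open import Data.Sum.Base using (_⊎_; inj₁; inj₂)
open import Data.Sum.Function.Propositional using (_⊎-↔_)
open import Function.Base using (_∘_)
open import Function.Bundles using (Inverse; _↔_; mk↔ₛ′)
open import Function.Construct.Composition as Compose using (_↔-∘_)
open import Function.Construct.Identity using (↔-id)
open import Function.Construct.Symmetry as Symmetry using (↔-sym)
open import Level using (0ℓ)
open import Relation.Binary.Bundles using (Setoid)
import Relation.Binary.Construct.On as On
open import Relation.Binary.Definitions using (DecidableEquality)
open import Relation.Binary.PropositionalEquality
open import Relation.Nullary using (Dec; does; yes; no; ¬_; contradiction)
open import Relation.Nullary.Decidable using (dec-true; dec-false)

open import Defs

open Algebra.Properties.Semiring.Sum +-*-semiring
  using (sum-syntax; sum-cong-≗; ∑-distrib-+; ∑-comm; ∑-permute; *-distribˡ-sum; *-distribʳ-sum)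

-- Finite sums and cardinalities

∑-mono : ∀ n {f g : Fin n → ℕ} → (∀ i → f i ≤ g i) → ∑[ i < n ] f i ≤ ∑[ i < n ] g i
∑-mono zero    f≤g = z≤n
∑-mono (suc n) f≤g = +-mono-≤ (f≤g zero) (∑-mono n (f≤g ∘ suc))

∑-const : ∀ n x → ∑[ i < n ] x ≡ n * x
∑-const zero    x = refl
∑-const (suc n) x = cong (x +_) (∑-const n x)

∑-↑ : ∀ m {n} (f : Fin (m + n) → ℕ) →
      ∑[ i < m + n ] f i ≡ ∑[ i < m ] f (i ↑ˡ n) + ∑[ j < n ] f (m ↑ʳ j)
∑-↑ zero    f = refl
∑-↑ (suc m) f = trans (cong (f zero +_) (∑-↑ m (f ∘ suc))) (sym (+-assoc (f zero) _ _))

∑-combine : ∀ m {n} (f : Fin (m * n) → ℕ) →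
            ∑[ k < m * n ] f k ≡ ∑[ i < m ] ∑[ j < n ] f (combine i j)
∑-combine zero        f = refl
∑-combine (suc m) {n} f = trans (∑-↑ n f) (cong (∑[ j < n ] f (j ↑ˡ (m * n)) +_) (∑-combine m (f ∘ (n ↑ʳ_))))

∑-remQuot : ∀ m n (f : Fin m × Fin n → ℕ) →
            ∑[ k < m * n ] f (remQuot n k) ≡ ∑[ i < m ] ∑[ j < n ] f (i , j)
∑-remQuot m n f = trans (∑-combine m {n} (f ∘ remQuot n))
  (sum-cong-≗ λ i → sum-cong-≗ λ j → cong f (remQuot-combine i j))

total : ∀ {S m} → HasCardinality S m → (Setoid.Carrier S → ℕ) → ℕ
total {m = m} e g = ∑[ i < m ] g (Inverse.from e i)

Invariant : (S : Setoid 0ℓ 0ℓ) → (Setoid.Carrier S → ℕ) → Set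
Invariant S g = ∀ {x y} → Setoid._≈_ S x y → g x ≡ g y

total-mono : ∀ {S m} (e : HasCardinality S m) {f g} → (∀ x → f x ≤ g x) → total e f ≤ total e g
total-mono {m = m} e f≤g = ∑-mono m (λ i → f≤g (Inverse.from e i))

-- Conjugating `φ` by the two enumerations gives a bijection of index sets. The function `g` has to
-- respect `_≈_` because the round trip through `e′` returns an element only up to that relation.
total-reindex : ∀ {S S′ m m′} (e : HasCardinality S m) (e′ : HasCardinality S′ m′) (φ : Inverse S S′)
                {g} → Invariant S′ g → total e (g ∘ Inverse.to φ) ≡ total e′ g
total-reindex {S} {S′} {m} {m′} e e′ φ {g} g-inv = sym (trans
  (∑-permute (g ∘ Inverse.from e′) π)
  (sum-cong-≗ {m} λ i → g-inv (Inverse.strictlyInverseʳ e′ (Inverse.to φ (Inverse.from e i)))))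
  where
  π = Compose.inverse (Compose.inverse (Symmetry.inverse e) φ) e′

×-cardinality : ∀ {S S′ m n} → HasCardinality S m → HasCardinality S′ n → HasCardinality (S ×ₛ S′) (m * n)
×-cardinality e e′ =
  Compose.inverse (e ×-inverse e′) (Compose.inverse Pointwise-≡↔≡ (↔-sym *↔×))

total-× : ∀ {S S′ m n} (e : HasCardinality S m) (e′ : HasCardinality S′ n) g →
          total (×-cardinality e e′) g ≡ total e (λ x → total e′ (λ y → g (x , y)))
total-× {m = m} {n} e e′ g = ∑-remQuot m n λ (i , j) → g (Inverse.from e i , Inverse.from e′ j)

funToFin-cong : ∀ {m n} {f g : Fin m → Fin n} → f ≗ g → funToFin f ≡ funToFin g
funToFin-cong {zero}  f≗g = refl
funToFin-cong {suc m} f≗g = cong₂ combine (f≗g zero) (funToFin-cong (f≗g ∘ suc))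

-- Conjugation by `α` and `β` turns a function into a string of `m` digits in base `n`, which
-- `funToFin` reads as a number.
→-cardinality : ∀ {A B : Set} {m n} → HasCardinality (setoid A) m → HasCardinality (setoid B) n →
                HasCardinality (A →-setoid B) (n ^ m)
→-cardinality {A} {B} {m} {n} α β = record
  { to = λ f → funToFin (β.to ∘ f ∘ α.from)
  ; from = λ k → β.from ∘ finToFun {n} {m} k ∘ α.to
  ; to-cong = λ f≗g → funToFin-cong λ i → cong β.to (f≗g (α.from i))
  ; from-cong = λ { refl _ → refl }
  ; inverse =
      (λ {k} f≗ → trans (funToFin-cong λ i → trans (cong β.to (f≗ (α.from i)))
            (trans (β.strictlyInverseˡ _) (cong (finToFun {n} {m} k) (α.strictlyInverseˡ i))))
          (funToFin-finToFin {m} k))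
    , (λ { {f} refl a → trans
            (cong β.from (trans (finToFun-funToFin (β.to ∘ f ∘ α.from) (α.to a))
                                (cong (β.to ∘ f) (α.strictlyInverseʳ a))))
            (β.strictlyInverseʳ _) })
  }
  where
  module α = Inverse α
  module β = Inverse β

⟦_⟧ : Bool → ℕ
⟦ false ⟧ = 0
⟦ true  ⟧ = 1

T↔Fin : ∀ b → T b ↔ Fin ⟦ b ⟧
T↔Fin false = ↔-sym 0↔⊥
T↔Fin true  = ↔-sym 1↔⊤

Σ-T↔⊎ : ∀ {n} (χ : Fin (suc n) → Bool) →
        Σ (Fin (suc n)) (T ∘ χ) ↔ (T (χ zero) ⊎ Σ (Fin n) (T ∘ χ ∘ suc))
Σ-T↔⊎ χ = mk↔ₛ′
  (λ { (zero , h) → inj₁ h ; (suc i , h) → inj₂ (i , h) })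
  (λ { (inj₁ h) → zero , h ; (inj₂ (i , h)) → suc i , h })
  (λ { (inj₁ h) → refl ; (inj₂ (i , h)) → refl })
  (λ { (zero , h) → refl ; (suc i , h) → refl })

Σ-T↔Fin : ∀ n (χ : Fin n → Bool) → Σ (Fin n) (T ∘ χ) ↔ Fin (∑[ i < n ] ⟦ χ i ⟧)
Σ-T↔Fin zero    χ = mk↔ₛ′ (λ ()) (λ ()) (λ ()) (λ ())
Σ-T↔Fin (suc n) χ =
  ↔-sym +↔⊎ ↔-∘ ((T↔Fin (χ zero) ⊎-↔ Σ-T↔Fin n (χ ∘ suc)) ↔-∘ Σ-T↔⊎ χ)

-- Elements of the subset are compared by first component only, so a proof of `B x` can be traded
-- for one of `T (χ x)`. The latter is unique, which lets propositional equality on the index side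
-- match `_≈_`.
subset-cardinality : ∀ {S m} (e : HasCardinality S m) {B : Setoid.Carrier S → Set}
  (χ : Setoid.Carrier S → Bool) → (∀ {x y} → Setoid._≈_ S x y → χ x ≡ χ y) →
  (∀ {x} → T (χ x) → B x) → (∀ {x} → B x → T (χ x)) →
  HasCardinality (On.setoid {B = Σ (Setoid.Carrier S) B} S proj₁) (total e (⟦_⟧ ∘ χ))
subset-cardinality {S} {m} e {B} χ χ-cong sound complete = Compose.inverse φ (Σ-T↔Fin m (χ ∘ e.from))
  where
  module e = Inverse e
  χ-from-to : ∀ {x} → χ x ≡ χ (e.from (e.to x))
  χ-from-to = χ-cong (Setoid.sym S (e.strictlyInverseʳ _))
  ≡-Σ : ∀ {i j h h′} → i ≡ j → _≡_ {A = Σ (Fin m) (T ∘ χ ∘ e.from)} (i , h) (j , h′)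
  ≡-Σ {i} refl = cong (i ,_) (T-irrelevant _ _)
  φ : Inverse (On.setoid {B = Σ (Setoid.Carrier S) B} S proj₁) (setoid (Σ (Fin m) (T ∘ χ ∘ e.from)))
  φ = record
    { to = λ (x , b) → e.to x , subst T χ-from-to (complete b)
    ; from = λ (i , h) → e.from i , sound h
    ; to-cong = λ x≈y → ≡-Σ (e.to-cong x≈y)
    ; from-cong = λ { refl → Setoid.refl S }
    ; inverse = (λ x≈ → ≡-Σ (e.inverseˡ x≈)) , (λ { refl → e.strictlyInverseʳ _ })
    }

-- Runs without repeated states

infix 4 _∈?_
_∈?_ : ∀ {n} (q : Fin n) (V : List (Fin n)) → Dec (q ∈ V)
_∈?_ {n} = DecMembership._∈?_ (_≟_ {n})

-- k bounds the number of further steps, V lists the states reached before s.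
escapes : ∀ {n} → ℕ → Program n → List (Fin n) → Status n → Bool
escapes k       p V offTape         = true
escapes k       p V halted          = false
escapes zero    p V (running q h T) = false
escapes (suc k) p V (running q h T) with q ∈? V
... | yes _ = false
... | no  _ = escapes k p (q ∷ V) (step p (running q h T))

outcome : ∀ {n} → ℕ → Tape → Action n → Status n
outcome h T (r , j , d) = enter r (move d h) (write h j T)

step-running : ∀ {n} (p : Program n) q h T → step p (running q h T) ≡ outcome h T (p (q , T h))
step-running p q h T with p (q , T h)
... | _ = refl

-- Meeting a state of `V` ends the test before its entry is read. This is how independence of the
-- consulted entries enters: what follows does not depend on entries already used.
escapes-local : ∀ {n} k (p p′ : Program n) V s → (∀ {q i} → q ∉ V → p (q , i) ≡ p′ (q , i)) →
                escapes k p V s ≡ escapes k p′ V s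
escapes-local k       p p′ V offTape         p≈p′ = refl
escapes-local k       p p′ V halted          p≈p′ = refl
escapes-local zero    p p′ V (running q h T) p≈p′ = refl
escapes-local (suc k) p p′ V (running q h T) p≈p′ with q ∈? V
... | yes _  = refl
... | no q∉V = trans (cong (escapes k p (q ∷ V)) step≡)
  (escapes-local k p p′ (q ∷ V) (step p′ (running q h T)) λ q∉ → p≈p′ (q∉ ∘ there))
  where
  step≡ : step p (running q h T) ≡ step p′ (running q h T)
  step≡ = trans (step-running p q h T) (trans (cong (outcome h T) (p≈p′ q∉V)) (sym (step-running p′ q h T)))

running-injective : ∀ {n q q′ h h′ T T′} → running {n} q h T ≡ running q′ h′ T′ → q ≡ q′
running-injective refl = refl

module _ {n} .{{_ : NonZero n}} (p : Program n) (input : Tape) where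

  Clean : ℕ → Set
  Clean i = (∀ {a} → a < i → run p input a ≢ halted) ×
            (∀ {a b q} → a < b → b < i → InState p input a q → ¬ InState p input b q)

  -- With this inclusion, a state outside `V` is new. The converse direction below works with the
  -- opposite inclusion.
  Records : ℕ → List (Fin n) → Set
  Records i V = ∀ {a q} → a < i → InState p input a q → q ∈ V

  Clean-suc : ∀ {i} → Clean i → run p input i ≢ halted →
              (∀ {a q} → a < i → InState p input a q → ¬ InState p input i q) → Clean (suc i)
  Clean-suc {i} (alive , distinct) alive-i distinct-i = alive′ , distinct′
    where
    alive′ : ∀ {a} → a < suc i → run p input a ≢ halted
    alive′ (s≤s a≤i) with m≤n⇒m<n∨m≡n a≤i
    ... | inj₁ a<i  = alive a<i
    ... | inj₂ refl = alive-i
    distinct′ : ∀ {a b q} → a < b → b < suc i → InState p input a q → ¬ InState p input b q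
    distinct′ a<b (s≤s b≤i) with m≤n⇒m<n∨m≡n b≤i
    ... | inj₁ b<i  = distinct a<b b<i
    ... | inj₂ refl = distinct-i a<b

  escapes-sound : ∀ k {i} V s → run p input i ≡ s → Clean i → Records i V →
                  T (escapes k p V s) → FallsOffFirst input n p
  -- Extending `Clean` past the time `i` itself turns its strict bounds into the inclusive ones of
  -- `HaltsBy` and `RepeatsStateBy`.
  escapes-sound k {i} V offTape s≡ clean V-records e =
    i , s≡ , (λ (_ , a≤i , h) → proj₁ clean′ (s≤s a≤i) h)
      , λ (_ , _ , a<b , b≤i , _ , qa , qb) → proj₂ clean′ a<b (s≤s b≤i) qa qb
    where
    clean′ : Clean (suc i)
    clean′ = Clean-suc clean (λ h → contradiction (trans (sym s≡) h) λ ())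
      λ _ _ (_ , _ , h) → contradiction (trans (sym s≡) h) λ ()
  escapes-sound zero    V (running q h T) s≡ clean V-records ()
  escapes-sound (suc k) {i} V (running q h T) s≡ clean V-records e with q ∈? V
  ... | no q∉V = escapes-sound k (q ∷ V) (step p (running q h T)) (cong (step p) s≡)
    (Clean-suc clean (λ h → contradiction (trans (sym s≡) h) λ ())
      λ a<i qa (_ , _ , h) → q∉V (subst (_∈ V) (running-injective (trans (sym h) s≡)) (V-records a<i qa)))
    records′ e
    where
    records′ : Records (suc i) (q ∷ V)
    records′ (s≤s a≤i) (_ , _ , h) with m≤n⇒m<n∨m≡n a≤i
    ... | inj₁ a<i  = there (V-records a<i (_ , _ , h))
    ... | inj₂ refl = here (running-injective (trans (sym h) s≡))

  escapes⇒FallsOffFirst : ∀ k → T (escapes k p [] (running (start n) 0 input)) → FallsOffFirst input n p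
  escapes⇒FallsOffFirst k = escapes-sound k {0} [] _ refl ((λ ()) , (λ _ ())) (λ ())

  -- Fuel n suffices: a run of n steps that goes on would have reached n + 1 states.
  FallsOffFirst⇒escapes : FallsOffFirst input n p → T (escapes n p [] (running (start n) 0 input))
  FallsOffFirst⇒escapes (t , off , ¬halts , ¬repeats) = go n [] _ refl refl z≤n (λ _ ()) (λ ())
    where
    running⇒< : ∀ {i q h T} → run p input i ≡ running q h T → i ≤ t → i < t
    running⇒< s≡ i≤t with m≤n⇒m<n∨m≡n i≤t
    ... | inj₁ i<t  = i<t
    ... | inj₂ refl = contradiction (trans (sym s≡) off) λ ()
    extend : ∀ {i q h T} → run p input i ≡ running q h T → (∀ a → a < i → ∃[ q ] InState p input a q) →
             ∀ a → a < suc i → ∃[ q ] InState p input a q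
    extend s≡ reached a (s≤s a≤i) with m≤n⇒m<n∨m≡n a≤i
    ... | inj₁ a<i  = reached a a<i
    ... | inj₂ refl = _ , _ , _ , s≡
    -- The equation `i + k ≡ n` makes the fuel run out exactly at time `n`. Every member of `V` has
    -- been reached earlier, so a hit in `V` is a genuine repetition.
    go : ∀ k {i} V s → i + k ≡ n → run p input i ≡ s → i ≤ t →
         (∀ a → a < i → ∃[ q ] InState p input a q) →
         (∀ {q} → q ∈ V → ∃[ a ] a < i × InState p input a q) → T (escapes k p V s)
    go k    V offTape i+k≡n s≡ i≤t reached V-reached = _
    go k    V halted  i+k≡n s≡ i≤t reached V-reached = ¬halts (_ , i≤t , s≡)
    go zero {i} V (running q h T) i+k≡n s≡ i≤t reached V-reached
      with i≡n ← trans (sym (+-identityʳ i)) i+k≡n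
      with a , b , a<b , qa≡qb ← pigeonhole {n} {suc i} (s≤s (≤-reflexive (sym i≡n)))
                                    (λ a → proj₁ (extend s≡ reached (toℕ a) (toℕ<n a)))
      = ¬repeats (toℕ a , toℕ b , a<b , ≤-trans (≤-pred (toℕ<n b)) i≤t , _
          , proj₂ (extend s≡ reached (toℕ a) (toℕ<n a))
          , subst (InState p input (toℕ b)) (sym qa≡qb) (proj₂ (extend s≡ reached (toℕ b) (toℕ<n b))))
    go (suc k) {i} V (running q h T) i+k≡n s≡ i≤t reached V-reached with q ∈? V
    ... | yes q∈V with a , a<i , qa ← V-reached q∈V
        = contradiction (a , i , a<i , i≤t , q , qa , _ , _ , s≡) ¬repeats
    ... | no _ = go k (q ∷ V) (step p (running q h T)) (trans (sym (+-suc i k)) i+k≡n)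
                    (cong (step p) s≡) (running⇒< s≡ i≤t) (extend s≡ reached)
                    λ { (here refl) → i , ≤-refl , _ , _ , s≡
                      ; (there q∈V) → let a , a<i , qa = V-reached q∈V in a , m<n⇒m<1+n a<i , qa }

-- The random walk

-- The number of ±1 walks of k steps from x that stay positive; x is one more than the cell index.
survivors : ℕ → ℕ → ℕ
survivors k       zero    = 0
survivors zero    (suc x) = 1
survivors (suc k) (suc x) = survivors k x + survivors k (suc (suc x))

survivors≤2^ : ∀ k x → survivors k x ≤ 2 ^ k
survivors≤2^ k       zero    = z≤n
survivors≤2^ zero    (suc x) = ≤-refl
survivors≤2^ (suc k) (suc x) = begin
  survivors k x + survivors k (suc (suc x)) ≤⟨ +-mono-≤ (survivors≤2^ k x) (survivors≤2^ k (suc (suc x))) ⟩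
  2 ^ k + 2 ^ k                             ≡⟨ cong (2 ^ k +_) (+-identityʳ (2 ^ k)) ⟨
  2 ^ suc k                                 ∎
  where open ≤-Reasoning

-- Optional stopping on [0, x + y]: the walk ends at x + y with chance x / (x + y), and k times the
-- chance of not having ended by time k is at most the expected exit time x y.
survivors-bound : ∀ k x y → k * ((x + y) * survivors k x) ≤ 2 ^ k * (k * x + (x + y) * (x * y))
survivors-bound zero    x       y = z≤n
survivors-bound (suc k) zero    y = begin
  suc k * (y * 0) ≡⟨ cong (suc k *_) (*-zeroʳ y) ⟩
  suc k * 0       ≡⟨ *-zeroʳ (suc k) ⟩
  0               ≤⟨ z≤n ⟩
  2 ^ suc k * (suc k * 0 + y * 0) ∎
  where open ≤-Reasoning
-- At the upper end the chance `x / (x + y)` is one, so the trivial bound `2 ^ suc k` is enough.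
survivors-bound (suc k) (suc x) zero = begin
  suc k * ((suc x + 0) * survivors (suc k) (suc x))
    ≤⟨ *-monoʳ-≤ (suc k) (*-monoʳ-≤ (suc x + 0) (survivors≤2^ (suc k) (suc x))) ⟩
  suc k * ((suc x + 0) * 2 ^ suc k)
    ≤⟨ m≤m+n _ _ ⟩
  suc k * ((suc x + 0) * 2 ^ suc k) + 2 ^ suc k * ((suc x + 0) * (suc x * 0))
    ≡⟨ rearrange (suc k) (suc x) (2 ^ suc k) ⟩
  2 ^ suc k * (suc k * suc x + (suc x + 0) * (suc x * 0)) ∎
  where
  open ≤-Reasoning
  rearrange : ∀ k x e → k * ((x + 0) * e) + e * ((x + 0) * (x * 0)) ≡ e * (k * x + (x + 0) * (x * 0))
  rearrange = solve-∀
survivors-bound (suc k) (suc x) (suc y) = begin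
  suc k * (M * (U₁ + U₂))
    -- Both neighbours keep the interval length `M`, so the induction hypothesis applies to each;
    -- passing from `k` to `suc k` leaves one surplus `M * (U₁ + U₂)`.
    ≡⟨ split k x y U₁ U₂ ⟩
  (k * ((x + suc (suc y)) * U₁) + k * ((suc (suc x) + y) * U₂)) + M * (U₁ + U₂)
    -- The trivially bounded surplus is paid for by the product: `x * (y + 2)` and `(x + 2) * y`
    -- average to one less than `(x + 1) * (y + 1)`.
    ≤⟨ +-mono-≤ (+-mono-≤ (survivors-bound k x (suc (suc y))) (survivors-bound k (suc (suc x)) y))
                (*-monoʳ-≤ M (survivors≤2^ (suc k) (suc x))) ⟩
  (P₁ + P₂) + M * (2 * e)
    -- The slack added here is the excess of `suc k * suc x` over `k * suc x`, scaled by `2 * e`.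
    ≤⟨ m≤m+n _ (2 * e * suc x) ⟩
  (P₁ + P₂) + M * (2 * e) + 2 * e * suc x
    ≡⟨ collect k x y e ⟩
  2 * e * (suc k * suc x + M * (suc x * suc y)) ∎
  where
  open ≤-Reasoning
  M = suc x + suc y
  U₁ = survivors k x
  U₂ = survivors k (suc (suc x))
  e = 2 ^ k
  P₁ = e * (k * x + (x + suc (suc y)) * (x * suc (suc y)))
  P₂ = e * (k * suc (suc x) + (suc (suc x) + y) * (suc (suc x) * y))
  split : ∀ k x y u v → suc k * ((suc x + suc y) * (u + v)) ≡
          (k * ((x + suc (suc y)) * u) + k * ((suc (suc x) + y) * v)) + (suc x + suc y) * (u + v)
  split = solve-∀
  collect : ∀ k x y e →
    (e * (k * x + (x + suc (suc y)) * (x * suc (suc y)))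
     + e * (k * suc (suc x) + (suc (suc x) + y) * (suc (suc x) * y)))
    + (suc x + suc y) * (2 * e) + 2 * e * suc x
    ≡ 2 * e * (suc k * suc x + (suc x + suc y) * (suc x * suc y))
  collect = solve-∀

-- Take `x = 1` and `y = m` in the previous bound. The number of steps is the square of the interval
-- length, so both terms on the right are at most `k`.
survivors-small : ∀ m → suc m * survivors (suc m * suc m) 1 ≤ 2 * 2 ^ (suc m * suc m)
survivors-small m = *-cancelˡ-≤ k (begin
  k * (suc m * survivors k 1)              ≤⟨ survivors-bound k 1 m ⟩
  2 ^ k * (k * 1 + suc m * (1 * m))        ≤⟨ *-monoʳ-≤ (2 ^ k) (+-mono-≤ (≤-reflexive (*-identityʳ k))
      (*-monoʳ-≤ (suc m) (≤-trans (≤-reflexive (*-identityˡ m)) (n≤1+n m)))) ⟩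
  2 ^ k * (k + k)                          ≡⟨ rearrange k (2 ^ k) ⟩
  k * (2 * 2 ^ k)                          ∎)
  where
  open ≤-Reasoning
  k = suc m * suc m
  rearrange : ∀ k e → e * (k + k) ≡ k * (2 * e)
  rearrange = solve-∀

-- Counting programs

⊗-cardinality : ∀ {A B : Set} {m n} → HasCardinality (setoid A) m → HasCardinality (setoid B) n →
                HasCardinality (setoid (A × B)) (m * n)
⊗-cardinality e e′ = Compose.inverse (Symmetry.inverse Pointwise-≡↔≡) (×-cardinality e e′)

module _ {A B : Set} (_≟A_ : DecidableEquality A) where

  update : (A → B) → A → B → A → B
  update f x b y = if does (y ≟A x) then b else f y

  update-same : ∀ f x b → update f x b x ≡ b
  update-same f x b rewrite dec-true (x ≟A x) refl = refl

  update-other : ∀ f {x y} b → y ≢ x → update f x b y ≡ f y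
  update-other f {x} {y} b y≢x rewrite dec-false (y ≟A x) y≢x = refl

  -- An involution, and hence resampling f at x with a uniform b preserves the uniform distribution.
  exchange : A → Inverse ((A →-setoid B) ×ₛ setoid B) ((A →-setoid B) ×ₛ setoid B)
  exchange x = record
    { to = swap
    ; from = swap
    ; to-cong = λ {u} {v} → swap-cong {u} {v}
    ; from-cong = λ {u} {v} → swap-cong {u} {v}
    ; inverse = (λ {u} {v} → swap-inverse {u} {v}) , (λ {u} {v} → swap-inverse {u} {v})
    }
    where
    swap : (A → B) × B → (A → B) × B
    swap (f , b) = update f x b , f x
    _≈_ : (A → B) × B → (A → B) × B → Set
    (f , b) ≈ (g , c) = (f ≗ g) × b ≡ c
    swap-cong : ∀ {u v} → u ≈ v → swap u ≈ swap v
    swap-cong {f , b} {g , .b} (f≗g , refl) = update-cong , f≗g x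
      where
      update-cong : update f x b ≗ update g x b
      update-cong y with does (y ≟A x)
      ... | true  = refl
      ... | false = f≗g y
    swap-swap : ∀ u → swap (swap u) ≈ u
    swap-swap (f , b) = restored , update-same f x b
      where
      restored : update (update f x b) x (f x) ≗ f
      restored y with y ≟A x
      ... | yes refl = refl
      ... | no  _    = refl
    swap-inverse : ∀ {u v} → v ≈ swap u → swap v ≈ u
    swap-inverse {u} {v} v≈ with f≗ , b≡ ← swap-cong {v} {swap u} v≈ | f≗′ , b≡′ ← swap-swap u =
      (λ y → trans (f≗ y) (f≗′ y)) , trans b≡ b≡′

  -- The first component of `exchange x` is the updated function, so reindexing pairs by it replaces
  -- `update f x b` by `f`, and each `f` is then counted `m` times.
  total-update : ∀ {c m} (e : HasCardinality (A →-setoid B) c) (e′ : HasCardinality (setoid B) m) x {g} →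
                 Invariant (A →-setoid B) g →
                 total e (λ f → total e′ (λ b → g (update f x b))) ≡ m * total e g
  total-update {c} {m} e e′ x {g} g-inv = begin
    total e (λ f → total e′ (λ b → g (update f x b)))
      ≡⟨ total-× e e′ (λ (f , b) → g (update f x b)) ⟨
    total (×-cardinality e e′) (λ (f , b) → g (update f x b))
      ≡⟨ total-reindex (×-cardinality e e′) (×-cardinality e e′) (exchange x) {g ∘ proj₁} (g-inv ∘ proj₁) ⟩
    total (×-cardinality e e′) (g ∘ proj₁)
      ≡⟨ total-× e e′ (g ∘ proj₁) ⟩
    total e (λ f → total e′ (λ _ → g f))
      ≡⟨ sum-cong-≗ {c} (λ i → ∑-const m (g (Inverse.from e i))) ⟩
    total e (λ f → m * g f)
      ≡⟨ *-distribˡ-sum m (g ∘ Inverse.from e) ⟨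
    m * total e g ∎
    where open ≡-Reasoning

target-cardinality : ∀ n → HasCardinality (setoid (Target n)) (suc n)
target-cardinality n = mk↔ₛ′
  (λ { halt → zero ; (state q) → suc q })
  (λ { zero → halt ; (suc q) → state q })
  (λ { zero → refl ; (suc q) → refl })
  (λ { halt → refl ; (state q) → refl })

direction-cardinality : HasCardinality (setoid Direction) 2
direction-cardinality = mk↔ₛ′
  (λ { L → zero ; R → suc zero })
  (λ { zero → L ; (suc zero) → R })
  (λ { zero → refl ; (suc zero) → refl })
  (λ { L → refl ; R → refl })

action-cardinality : ∀ n → HasCardinality (setoid (Action n)) (suc n * (2 * 2))
action-cardinality n =
  ⊗-cardinality (target-cardinality n) (⊗-cardinality (↔-id (Fin 2)) direction-cardinality)

∣programs∣ : ℕ → ℕ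
∣programs∣ n = (suc n * (2 * 2)) ^ (n * 2)

program-cardinality : ∀ n → HasCardinality (programs n) (∣programs∣ n)
program-cardinality n = →-cardinality (⊗-cardinality (↔-id (Fin n)) (↔-id (Fin 2))) (action-cardinality n)

-- The sum over targets is put innermost: halting and repetition depend on the target, while the
-- direction drives the walk and the symbol only doubles the count.
total-action : ∀ n (g : Action n → ℕ) →
  total (action-cardinality n) g ≡
  ∑[ j < 2 ] (total (target-cardinality n) (λ r → g (r , j , L)) +
             total (target-cardinality n) (λ r → g (r , j , R)))
total-action n g = begin
  total (action-cardinality n) g
    ≡⟨ total-× τ σδ g ⟩
  total τ (λ r → total σδ (λ jd → g (r , jd)))
    ≡⟨ ∑-comm {suc n} {2 * 2} (λ i k → g (Inverse.from τ i , Inverse.from σδ k)) ⟩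
  total σδ (λ jd → total τ (λ r → g (r , jd)))
    ≡⟨ total-× σ δ (λ jd → total τ (λ r → g (r , jd))) ⟩
  total σ (λ j → total δ (λ d → total τ (λ r → g (r , j , d))))
    ≡⟨ sum-cong-≗ {2} (λ j →
         cong (total τ (λ r → g (r , j , L)) +_) (+-identityʳ (total τ (λ r → g (r , j , R))))) ⟩
  ∑[ j < 2 ] (total τ (λ r → g (r , j , L)) + total τ (λ r → g (r , j , R))) ∎
  where
  open ≡-Reasoning
  τ = target-cardinality n
  σ = ↔-id (Fin 2)
  δ = direction-cardinality
  σδ = ⊗-cardinality σ δ

∑-≟ : ∀ n (x : Fin n) → ∑[ q < n ] ⟦ does (q ≟ x) ⟧ ≡ 1
∑-≟ (suc n) zero    = cong suc (trans (∑-const n 0) (*-zeroʳ n))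
∑-≟ (suc n) (suc x) = ∑-≟ n x

⟦∨⟧≤+ : ∀ a b → ⟦ a ∨ b ⟧ ≤ ⟦ a ⟧ + ⟦ b ⟧
⟦∨⟧≤+ false b = ≤-refl
⟦∨⟧≤+ true  b = s≤s z≤n

∑-∈≤length : ∀ n (V : List (Fin n)) → ∑[ q < n ] ⟦ does (q ∈? V) ⟧ ≤ length V
∑-∈≤length n []      = ≤-reflexive (trans (∑-const n 0) (*-zeroʳ n))
∑-∈≤length n (x ∷ V) = begin
  ∑[ q < n ] ⟦ does (q ∈? x ∷ V) ⟧
    ≤⟨ ∑-mono n (λ q → ⟦∨⟧≤+ (does (q ≟ x)) (does (q ∈? V))) ⟩
  ∑[ q < n ] (⟦ does (q ≟ x) ⟧ + ⟦ does (q ∈? V) ⟧)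
    ≡⟨ ∑-distrib-+ {n} (λ q → ⟦ does (q ≟ x) ⟧) (λ q → ⟦ does (q ∈? V) ⟧) ⟩
  ∑[ q < n ] ⟦ does (q ≟ x) ⟧ + ∑[ q < n ] ⟦ does (q ∈? V) ⟧
    ≤⟨ +-mono-≤ (≤-reflexive (∑-≟ n x)) (∑-∈≤length n V) ⟩
  suc (length V) ∎
  where open ≤-Reasoning

-- Programs that do not escape in time

⟦⟧≤1 : ∀ b → ⟦ b ⟧ ≤ 1
⟦⟧≤1 false = z≤n
⟦⟧≤1 true  = ≤-refl

-- Running out of the `k` steps counts as a miss, along with halting and repeating a state.
misses : ∀ {n} → ℕ → List (Fin n) → Status n → Program n → ℕ
misses k V s p = ⟦ not (escapes k p V s) ⟧

#misses : ∀ {n} → ℕ → List (Fin n) → Status n → ℕ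
#misses {n} k V s = total (program-cardinality n) (misses k V s)

misses-invariant : ∀ {n} k V s → Invariant (programs n) (misses k V s)
misses-invariant k V s {p} {p′} p≗p′ = cong (⟦_⟧ ∘ not) (escapes-local k p p′ V s λ _ → p≗p′ _)

#misses≤ : ∀ {n} k V s → #misses {n} k V s ≤ ∣programs∣ n
#misses≤ {n} k V s = begin
  #misses k V s             ≤⟨ total-mono (program-cardinality n) {misses k V s} {λ _ → 1} (λ p → ⟦⟧≤1 _) ⟩
  ∑[ i < ∣programs∣ n ] 1   ≡⟨ ∑-const (∣programs∣ n) 1 ⟩
  ∣programs∣ n * 1          ≡⟨ *-identityʳ _ ⟩
  ∣programs∣ n              ∎
  where open ≤-Reasoning

_≟ₓ_ : ∀ {n} → DecidableEquality (Fin n × Symbol)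
_≟ₓ_ = ≡-dec _≟_ _≟_

-- The new entry is read once, giving the action `a`. Afterwards `q` is on the list, so by locality
-- the rest of the run may use `p` itself.
escapes-update : ∀ {n} k (p : Program n) {V q} h T a → q ∉ V →
                 escapes (suc k) (update _≟ₓ_ p (q , T h) a) V (running q h T) ≡
                 escapes k p (q ∷ V) (outcome h T a)
escapes-update k p {V} {q} h T a q∉V with q ∈? V
... | yes q∈V = contradiction q∈V q∉V
... | no  _   = trans
  (cong (escapes k p′ (q ∷ V)) (trans (step-running p′ q h T)
    (cong (outcome h T) (update-same _≟ₓ_ p (q , T h) a))))
  (escapes-local k p′ p (q ∷ V) (outcome h T a) λ q′∉ → update-other _≟ₓ_ p a λ { refl → q′∉ (here refl) })
  where p′ = update _≟ₓ_ p (q , T h) a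

-- Resampling the entry about to be read makes the next action uniform and independent of the rest
-- of the program; exchanging the two sums then gives a one-step recursion.
#misses-suc : ∀ {n} k V q h T → q ∉ V →
  suc n * (2 * 2) * #misses (suc k) V (running q h T) ≡
  total (action-cardinality n) (λ a → #misses k (q ∷ V) (outcome h T a))
#misses-suc {n} k V q h T q∉V = begin
  suc n * (2 * 2) * #misses (suc k) V (running q h T)
    ≡⟨ total-update _≟ₓ_ E α (q , T h) {misses (suc k) V (running q h T)}
         (λ {p} {p′} → misses-invariant (suc k) V (running q h T) {p} {p′}) ⟨
  total E (λ p → total α (λ a → misses (suc k) V (running q h T) (update _≟ₓ_ p (q , T h) a)))
    ≡⟨ sum-cong-≗ {∣programs∣ n} (λ i → sum-cong-≗ {suc n * (2 * 2)} λ l →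
         cong (⟦_⟧ ∘ not) (escapes-update k (Inverse.from E i) h T (Inverse.from α l) q∉V)) ⟩
  total E (λ p → total α (λ a → misses k (q ∷ V) (outcome h T a) p))
    ≡⟨ ∑-comm {∣programs∣ n} {suc n * (2 * 2)} (λ i l →
         misses k (q ∷ V) (outcome h T (Inverse.from α l)) (Inverse.from E i)) ⟩
  total α (λ a → #misses k (q ∷ V) (outcome h T a)) ∎
  where
  open ≡-Reasoning
  E = program-cardinality n
  α = action-cardinality n

-- n + 1 times a bound on the chance of halting or repeating a state within k steps when v states
-- have already been reached.
collisions : ℕ → ℕ → ℕ
collisions zero    v = 0
collisions (suc k) v = 2 + v + collisions k (suc v)

-- One more than the cell moved to from cell h, with 0 for the position off the tape.
neighbour : Direction → ℕ → ℕ
neighbour L h = h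
neighbour R h = 2 + h

module _ (n : ℕ) where
  private
    D = suc n
    C = ∣programs∣ n
    τ = target-cardinality n

  -- This is `survivors / 2 ^ k + collisions / D` multiplied by `2 ^ k * D`, to stay within natural
  -- numbers.
  bound : ℕ → ℕ → ℕ → ℕ
  bound k v x = survivors k x * D + 2 ^ k * collisions k v

  -- The indicator term charges a repeated state with all `C` programs, so that the bound holds for
  -- every `q` and can be summed over all targets.
  BoundedAt : ℕ → List (Fin n) → Set
  BoundedAt k V = ∀ q h T →
    2 ^ k * D * #misses k V (running q h T) ≤ ⟦ does (q ∈? V) ⟧ * (2 ^ k * D * C) + bound k (length V) (suc h) * C

  -- The target `halt` costs `C`, the targets in `V` cost at most `length V` times `C`, which
  -- together give `suc (length V)`. The `n` ordinary contributions are rounded up to `D`.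
  enter-bound : ∀ k V → BoundedAt k V → ∀ h T →
    2 ^ k * D * total τ (λ r → #misses k V (enter r (just h) T)) ≤
    D * C * (2 ^ k * suc (length V) + bound k (length V) (suc h))
  enter-bound k V ih h T = begin
    Y * (#misses k V halted + ∑[ q < n ] W q)
      ≡⟨ *-distribˡ-+ Y (#misses k V halted) _ ⟩
    Y * #misses k V halted + Y * ∑[ q < n ] W q
      ≡⟨ cong (Y * #misses k V halted +_) (*-distribˡ-sum Y W) ⟩
    Y * #misses k V halted + ∑[ q < n ] (Y * W q)
      ≤⟨ +-mono-≤ (*-monoʳ-≤ Y (#misses≤ k V halted)) (∑-mono n (λ q → ih q h T)) ⟩
    Y * C + ∑[ q < n ] (i q * (Y * C) + b * C)
      ≡⟨ cong (Y * C +_) (∑-distrib-+ {n} (λ q → i q * (Y * C)) (λ _ → b * C)) ⟩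
    Y * C + (∑[ q < n ] (i q * (Y * C)) + ∑[ q < n ] (b * C))
      ≡⟨ cong (Y * C +_) (cong₂ _+_ (sym (*-distribʳ-sum (Y * C) i)) (∑-const n (b * C))) ⟩
    Y * C + ((∑[ q < n ] i q) * (Y * C) + n * (b * C))
      ≤⟨ +-monoʳ-≤ (Y * C) (+-mono-≤ (*-monoˡ-≤ (Y * C) (∑-∈≤length n V)) (*-monoˡ-≤ (b * C) (n≤1+n n))) ⟩
    Y * C + (length V * (Y * C) + D * (b * C))
      ≡⟨ rearrange (2 ^ k) D C (length V) b ⟩
    D * C * (2 ^ k * suc (length V) + b) ∎
    where
    open ≤-Reasoning
    Y = 2 ^ k * D
    W i : Fin n → ℕ
    W q = #misses k V (running q h T)
    i q = ⟦ does (q ∈? V) ⟧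
    b = bound k (length V) (suc h)
    rearrange : ∀ x d c v b → x * d * c + (v * (x * d * c) + d * (b * c)) ≡ d * c * (x * suc v + b)
    rearrange = solve-∀

  #misses-offTape : ∀ k V → #misses {n} k V offTape ≡ 0
  #misses-offTape k V = trans (∑-const C 0) (*-zeroʳ C)

  -- A left move from cell 0 gives no misses at all; `neighbour` is 0 there, where `survivors`
  -- vanishes too.
  move-bound : ∀ k V → BoundedAt k V → ∀ d h T →
    2 ^ k * D * total τ (λ r → #misses k V (enter r (move d h) T)) ≤
    D * C * (2 ^ k * suc (length V) + bound k (length V) (neighbour d h))
  move-bound k V ih L (suc h) T = enter-bound k V ih h T
  move-bound k V ih R h       T = enter-bound k V ih (suc h) T
  move-bound k V ih L zero    T = begin
    2 ^ k * D * total τ (λ r → #misses k V offTape)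
      ≡⟨ cong (2 ^ k * D *_) (trans (∑-const D (#misses k V offTape))
           (trans (cong (D *_) (#misses-offTape k V)) (*-zeroʳ D))) ⟩
    2 ^ k * D * 0 ≡⟨ *-zeroʳ (2 ^ k * D) ⟩
    0             ≤⟨ z≤n ⟩
    D * C * (2 ^ k * suc (length V) + bound k (length V) (neighbour L 0)) ∎
    where open ≤-Reasoning

  #misses-bound : ∀ k V → BoundedAt k V
  #misses-bound zero V q h T = begin
    1 * D * #misses 0 V (running q h T)         ≤⟨ *-monoʳ-≤ (1 * D) (#misses≤ 0 V (running q h T)) ⟩
    1 * D * C                                   ≡⟨ cong (_* C) (sym (+-identityʳ (1 * D))) ⟩
    bound 0 (length V) (suc h) * C              ≤⟨ m≤n+m _ (⟦ does (q ∈? V) ⟧ * (1 * D * C)) ⟩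
    ⟦ does (q ∈? V) ⟧ * (1 * D * C) + bound 0 (length V) (suc h) * C ∎
    where open ≤-Reasoning
  #misses-bound (suc k) V q h T = by-cases (q ∈? V)
    where
    open ≤-Reasoning
    V′ = q ∷ V
    ih = #misses-bound k V′
    v = length V
    x = 2 ^ k
    w = #misses (suc k) V (running q h T)
    w₀ w₁ b : Direction → ℕ
    w₀ d = total τ (λ r → #misses k V′ (outcome h T (r , zero , d)))
    w₁ d = total τ (λ r → #misses k V′ (outcome h T (r , suc zero , d)))
    b d = x * suc (suc v) + bound k (suc v) (neighbour d h)
    regroup : ∀ x d w → 2 * d * (2 * x * d * w) ≡ x * d * (d * 4 * w)
    regroup = solve-∀
    distribute : ∀ y a b c d → y * ((a + b) + ((c + d) + 0)) ≡ (y * a + y * b) + (y * c + y * d)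
    distribute = solve-∀
    collect : ∀ x d c v s t e →
      (d * c * (x * suc (suc v) + (s * d + x * e)) + d * c * (x * suc (suc v) + (t * d + x * e))) +
      (d * c * (x * suc (suc v) + (s * d + x * e)) + d * c * (x * suc (suc v) + (t * d + x * e))) ≡
      2 * d * (((s + t) * d + 2 * x * (2 + v + e)) * c)
    collect = solve-∀
    by-cases : (d : Dec (q ∈ V)) → 2 * x * D * w ≤ ⟦ does d ⟧ * (2 * x * D * C) + bound (suc k) v (suc h) * C
    -- All programs together number `C`, which the indicator term already covers.
    by-cases (yes _) = ≤-trans (*-monoʳ-≤ (2 ^ suc k * D) (#misses≤ (suc k) V (running q h T)))
      (≤-trans (≤-reflexive (sym (*-identityˡ _))) (m≤m+n _ _))
    -- The factor `2 * D` completes the left side to `x * D` times `D * 4`, the number of actions,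
    -- so that the recursion applies.
    by-cases (no q∉V) = *-cancelˡ-≤ (2 * D) (begin
      2 * D * (2 * x * D * w)
        ≡⟨ regroup x D w ⟩
      x * D * (D * 4 * w)
        ≡⟨ cong (x * D *_) (trans (#misses-suc k V q h T q∉V) (total-action n (λ a → #misses k V′ (outcome h T a)))) ⟩
      x * D * ((w₀ L + w₀ R) + ((w₁ L + w₁ R) + 0))
        ≡⟨ distribute (x * D) (w₀ L) (w₀ R) (w₁ L) (w₁ R) ⟩
      (x * D * w₀ L + x * D * w₀ R) + (x * D * w₁ L + x * D * w₁ R)
        ≤⟨ +-mono-≤ (+-mono-≤ (move-bound k V′ ih L h _) (move-bound k V′ ih R h _))
                    (+-mono-≤ (move-bound k V′ ih L h _) (move-bound k V′ ih R h _)) ⟩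
      (D * C * b L + D * C * b R) + (D * C * b L + D * C * b R)
        -- The recursions of `survivors` and `collisions` are assembled here; `2 + v` stands for
        -- halting and the `v + 1` states of `V′`.
        ≡⟨ collect x D C v (survivors k h) (survivors k (2 + h)) (collisions k (suc v)) ⟩
      2 * D * (bound (suc k) v (suc h) * C) ∎)

  -- Of the chance `3 / M`, the walk accounts for `2 / M` and, by the lower bound on `D`, collisions
  -- for `1 / M`.
  #misses-small : ∀ m q T → let M = suc m; k = M * M in M * collisions k 0 ≤ D →
    M * #misses k [] (running q 0 T) ≤ 3 * C
  #misses-small m q T Me≤D = *-cancelˡ-≤ (x * D) {{m*n≢0 x D {{m^n≢0 2 k}}}} (begin
    x * D * (M * w)                      ≡⟨ regroup x D M w ⟩
    M * (x * D * w)                      ≤⟨ *-monoʳ-≤ M (#misses-bound k [] q 0 T) ⟩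
    M * ((survivors k 1 * D + x * e) * C) ≡⟨ distribute M (survivors k 1) D x e C ⟩
    (M * survivors k 1 * D + x * (M * e)) * C
      ≤⟨ *-monoˡ-≤ C (+-mono-≤ (*-monoˡ-≤ D (survivors-small m)) (*-monoʳ-≤ x Me≤D)) ⟩
    (2 * x * D + x * D) * C              ≡⟨ collect x D C ⟩
    x * D * (3 * C)                      ∎)
    where
    open ≤-Reasoning
    M = suc m
    k = M * M
    x = 2 ^ k
    e = collisions k 0
    w = #misses k [] (running q 0 T)
    regroup : ∀ x d m w → x * d * (m * w) ≡ m * (x * d * w)
    regroup = solve-∀
    distribute : ∀ m s d x e c → m * ((s * d + x * e) * c) ≡ (m * s * d + x * (m * e)) * c
    distribute = solve-∀
    collect : ∀ x d c → (2 * x * d + x * d) * c ≡ x * d * (3 * c)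
    collect = solve-∀

-- Passage to the limit

-- Strictness comes from the extra 1 in `suc (3 * q)` when `w` is positive, and from `0 < c` when
-- `w` is zero.
cancel-3 : ∀ q w c → suc (3 * q) * w ≤ 3 * c → 0 < c → w * q < c
cancel-3 q zero    c _  0<c = 0<c
cancel-3 q (suc w) c le _   = *-cancelˡ-< 3 (suc w * q) c (<-≤-trans (begin-strict
  3 * (suc w * q)            ≡⟨ regroup q (suc w) ⟩
  3 * q * suc w              <⟨ m<n+m (3 * q * suc w) (s≤s z≤n) ⟩
  suc (3 * q) * suc w        ∎) le)
  where
  open ≤-Reasoning
  regroup : ∀ q w → 3 * (w * q) ≡ 3 * q * w
  regroup = solve-∀

open import Data.Integer.Base using (+_; +<+)

-- The distance equals `d / c`, and a positive `ε` has numerator at least 1, hence is at least the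
-- reciprocal of its denominator.
∣b/c-1∣<ε : ∀ b c d .{{_ : NonZero c}} ε → 0ℚ ℚ.< ε → b + d ≡ c → d * ↧ₙ ε < c →
            ℚ.∣ (+ b) ℚ./ c ℚ.- 1ℚ ∣ ℚ.< ε
∣b/c-1∣<ε b c@(suc c-1) d ε@(mkℚ (+ suc a) q-1 _) 0<ε b+d≡c dq<c =
  ℚ.toℚᵘ-cancel-< (ℚᵘ.<-respˡ-≃ (ℚᵘ.≃-sym distance≃) (ℚᵘ.*<* cross))
  where
  b≤c : b ≤ c
  b≤c = ≤-trans (m≤m+n b d) (≤-reflexive b+d≡c)
  numerator : ℤ.∣ + b ℤ.* + 1 ℤ.+ ℤ.-1ℤ ℤ.* + c ∣ ≡ d
  numerator = begin
    ℤ.∣ + b ℤ.* + 1 ℤ.+ ℤ.-1ℤ ℤ.* + c ∣ ≡⟨ cong ℤ.∣_∣ (cong₂ ℤ._+_ (ℤ.*-identityʳ (+ b)) (ℤ.-1*i≡-i (+ c))) ⟩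
    ℤ.∣ + b ℤ.- + c ∣                    ≡⟨ cong ℤ.∣_∣ (ℤ.m-n≡m⊖n b c) ⟩
    ℤ.∣ b ℤ.⊖ c ∣                        ≡⟨ ℤ.∣⊖∣-≤ b≤c ⟩
    c ∸ b                                ≡⟨ cong (_∸ b) b+d≡c ⟨
    b + d ∸ b                            ≡⟨ m+n∸m≡n b d ⟩
    d                                    ∎
    where open ≡-Reasoning
  cross : + d ℤ.* + suc q-1 ℤ.< + suc a ℤ.* + (c * 1)
  cross = begin-strict
    + d ℤ.* + suc q-1     ≡⟨ ℤ.pos-* d (suc q-1) ⟨
    + (d * suc q-1)       <⟨ +<+ dq<c ⟩
    + c                   ≤⟨ ℤ.+≤+ (≤-trans (≤-reflexive (sym (*-identityʳ c))) (m≤m+n (c * 1) (a * (c * 1)))) ⟩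
    + (suc a * (c * 1))   ≡⟨ ℤ.pos-* (suc a) (c * 1) ⟩
    + suc a ℤ.* + (c * 1) ∎
    where open ℤ.≤-Reasoning
  -- `mkℚᵘ` stores the denominator less one, so `c-1 * 1` encodes `c * 1`.
  distance≃ : toℚᵘ ℚ.∣ (+ b) ℚ./ c ℚ.- 1ℚ ∣ ℚᵘ.≃ mkℚᵘ (+ d) (c-1 * 1)
  distance≃ = begin
    toℚᵘ ℚ.∣ (+ b) ℚ./ c ℚ.- 1ℚ ∣            ≈⟨ ℚ.toℚᵘ-homo-∣-∣ ((+ b) ℚ./ c ℚ.- 1ℚ) ⟩
    ℚᵘ.∣ toℚᵘ ((+ b) ℚ./ c ℚ.- 1ℚ) ∣         ≈⟨ ℚᵘ.∣-∣-cong (ℚ.toℚᵘ-homo-+ ((+ b) ℚ./ c) (ℚ.- 1ℚ)) ⟩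
    ℚᵘ.∣ toℚᵘ ((+ b) ℚ./ c) ℚᵘ.- ℚᵘ.1ℚᵘ ∣    ≈⟨ ℚᵘ.∣-∣-cong (ℚᵘ.+-congˡ (ℚᵘ.- ℚᵘ.1ℚᵘ) (ℚ.toℚᵘ-fromℚᵘ (mkℚᵘ (+ b) c-1))) ⟩
    ℚᵘ.∣ mkℚᵘ (+ b) c-1 ℚᵘ.- ℚᵘ.1ℚᵘ ∣        ≡⟨ cong (λ m → mkℚᵘ (+ m) (c-1 * 1)) numerator ⟩
    mkℚᵘ (+ d) (c-1 * 1)                     ∎
    where open ℚᵘ.≃-Reasoning
∣b/c-1∣<ε b c d (mkℚ (+ zero) q-1 _) (ℚ.*<* (+<+ ())) b+d≡c dq<c
∣b/c-1∣<ε b c d (mkℚ ℤ.-[1+ a ] q-1 _) (ℚ.*<* ()) b+d≡c dq<c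

⟦b⟧+⟦not-b⟧ : ∀ b → ⟦ b ⟧ + ⟦ not b ⟧ ≡ 1
⟦b⟧+⟦not-b⟧ false = refl
⟦b⟧+⟦not-b⟧ true  = refl

⟦not⟧-antitone : ∀ {a b} → (T a → T b) → ⟦ not b ⟧ ≤ ⟦ not a ⟧
⟦not⟧-antitone {b = true}          a⇒b = z≤n
⟦not⟧-antitone {false} {false} a⇒b = ≤-refl
⟦not⟧-antitone {true}  {false} a⇒b = contradiction _ a⇒b

mainTheorem6 : (input : Tape) → HasAsymptoticProbability (FallsOffFirst input) 1ℚ
-- The threshold makes the collision hypothesis of `#misses-small` hold. Fuel `n` gives the exact
-- count, while the fixed fuel `k` gives the estimate.
mainTheorem6 input ε 0<ε = M * collisions k 0 , λ n Me≤n →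
  let
    E = program-cardinality n
    s₀ = running (start n) 0 input
    χ = λ p → escapes n p [] s₀
    b = total E (⟦_⟧ ∘ χ)
    d = #misses n [] s₀
    C = ∣programs∣ n
    C≢0 : NonZero C
    C≢0 = m^n≢0 (suc n * (2 * 2)) (n * 2)
    b+d≡C : b + d ≡ C
    b+d≡C = trans (sym (∑-distrib-+ (⟦_⟧ ∘ χ ∘ Inverse.from E) (misses n [] s₀ ∘ Inverse.from E)))
      (trans (sum-cong-≗ (λ i → ⟦b⟧+⟦not-b⟧ (χ (Inverse.from E i)))) (trans (∑-const C 1) (*-identityʳ C)))
    -- The comparison of fuels goes through `FallsOffFirst`, so it holds whichever of `k` and `n` is
    -- larger.
    d≤ : d ≤ #misses k [] s₀
    d≤ = total-mono E {misses n [] s₀} {misses k [] s₀} λ p →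
      ⟦not⟧-antitone (FallsOffFirst⇒escapes p input ∘ escapes⇒FallsOffFirst p input k)
  in
  b , C , C≢0
  , subset-cardinality E χ (λ {p} {p′} p≗p′ → escapes-local n p p′ [] s₀ (λ _ → p≗p′ _))
      (λ {p} → escapes⇒FallsOffFirst p input n) (λ {p} → FallsOffFirst⇒escapes p input)
  , E
  , ∣b/c-1∣<ε b C d {{C≢0}} ε 0<ε b+d≡C
      (≤-<-trans (*-monoˡ-≤ (↧ₙ ε) d≤)
        (cancel-3 (↧ₙ ε) (#misses k [] s₀) C
          (#misses-small n (3 * ↧ₙ ε) (start n) input (m≤n⇒m≤1+n Me≤n)) (>-nonZero⁻¹ C {{C≢0}})))
  where
  -- Chosen so that `3 / M` is below `1 / ↧ₙ ε`.
  M = suc (3 * ↧ₙ ε)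
  k = M * M
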